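{- Fix integers $2\le r\le k$. There is a constant $c=c(k,r)>0$ such that every $k$-uniform multihypergraph $H$ with $m$ edges and strong chromatic number $\chi$ has an $r$-cut with excess at least $cm/\chi$.
   Context: A $k$-uniform multihypergraph has a vertex set and a multiset of $k$-element vertex subsets (edges, repetitions allowed). A strong colouring is a colouring of the vertices in which all vertices of each edge receive distinct colours; the strong chromatic number is the minimum number of colours in a strong colouring. An $r$-cut is a partition of the vertex set into $r$ labelled parts; its size is the number of edges (counted with multiplicity) having a vertex in every part; its excess is its size minus $\frac{S(k,r)r!}{r^k}m$, where $S(k,r)$ is the Stirling number of the second kind (this is the expected size of a uniformly random $r$-cut). -}

module Defs where

open import Data.Nat using (ℕ; zero; suc; _+_; _*_; _^_; _≤_; _!)
open import Data.Nat.Properties using (m^n≢0)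

open import Data.Integer using (ℤ; +_)
open import Data.Rational using (ℚ; _/_; 0ℚ; _-_)
open import Data.Fin using (Fin; _≟_)
open import Data.Fin.Subset using (Subset; _∈_; ∣_∣)
open import Data.Fin.Subset.Properties using (_∈?_)
open import Data.Fin.Properties using (any?; all?)
open import Data.List using (List; length; filter)
open import Data.List.Relation.Unary.All using (All)
open import Data.Product using (∃; _×_)
open import Relation.Nullary using (¬_; Dec; yes; no; _×-dec_)
open import Relation.Binary.PropositionalEquality using (_≡_)

-- Stirling numbers of the second kind: S n j = number of partitions of an
-- n-element set into j non-empty blocks.
S : ℕ → ℕ → ℕ
S zero    zero    = 1
S zero    (suc j) = 0
S (suc n) zero    = 0
S (suc n) (suc j) = suc j * S n (suc j) + S n j

-- A k-uniform multihypergraph on the vertex set Fin n: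
-- a list (multiset) of edges, each a k-element subset of the vertices.
record Hypergraph (k : ℕ) : Set where
  field
    n       : ℕ
    edges   : List (Subset n)
    uniform : All (λ e → ∣ e ∣ ≡ k) edges
open Hypergraph public

numEdges : ∀ {k} → Hypergraph k → ℕ
numEdges H = length (edges H)

IsStrongColouring : ∀ {k} (H : Hypergraph k) (q : ℕ) → (Fin (n H) → Fin q) → Set
IsStrongColouring H q f =
  All (λ e → ∀ u v → u ∈ e → v ∈ e → ¬ (u ≡ v) → ¬ (f u ≡ f v)) (edges H)

StrongColourable : ∀ {k} → Hypergraph k → ℕ → Set
StrongColourable H q = ∃ λ (f : Fin (n H) → Fin q) → IsStrongColouring H q f

IsStrongChromaticNumber : ∀ {k} → Hypergraph k → ℕ → Set
IsStrongChromaticNumber H χ =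
  StrongColourable H χ × (∀ q → StrongColourable H q → χ ≤ q)

-- an r-cut: partition of the vertices into r labelled (possibly empty) parts
Cut : ∀ {k} → Hypergraph k → ℕ → Set
Cut H r = Fin (n H) → Fin r

isCut? : ∀ {N r} (c : Fin N → Fin r) (e : Subset N) →
         Dec (∀ (j : Fin r) → ∃ λ v → v ∈ e × c v ≡ j)
isCut? c e = all? (λ j → any? (λ v → (v ∈? e) ×-dec (c v ≟ j)))

cutSize : ∀ {k r} (H : Hypergraph k) → Cut H r → ℕ
cutSize H c = length (filter (isCut? c) (edges H))

-- expected size S(k,r) r! m / r^k of a uniformly random r-cut
-- (junk value 0 for r = 0, which is excluded by the hypotheses)
expectedCutSize : ℕ → ℕ → ℕ → ℚ
expectedCutSize k zero    m = 0ℚ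
expectedCutSize k (suc r) m =
  _/_ (+ (S k (suc r) * (suc r) ! * m)) (suc r ^ k) {{m^n≢0 (suc r) k}}

excess : ∀ {k r} (H : Hypergraph k) → Cut H r → ℚ
excess {k} {r} H c = (+ cutSize H c / 1) - expectedCutSize k r (numEdges H)

{-# OPTIONS --safe #-}
-- Fix a strong colouring with χ colours and let a cut depend only on the colour of a vertex, so that an edge
-- becomes a set of k colours.  For s < 2 χ, the pairs a < b of colours with a + b = s form a matching.  Assign
-- parts to colours uniformly subject to matched colours getting different parts.  Conditioning on the matching
-- never lowers the probability that an edge meets all parts: if the two colours of a pair agree, one of them is
-- redundant.  When the edge contains a matched pair, the probability rises by at least r ^ -k.  Every edge
-- contains a matched pair for some s, so for the best s at least m / (2 χ) edges gain, and c = 1 / (2 r ^ k).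
module Submission where

open import Defs
open import Data.Nat using (ℕ; zero; suc; pred; _+_; _^_; _!; z≤n; s≤s; NonZero) renaming (_≤_ to _≤ℕ_; _<_ to _<ℕ_; _*_ to _·_)
import Data.Nat as ℕ
import Data.Nat.Properties as ℕ
open import Algebra.Properties.CommutativeSemigroup ℕ.*-commutativeSemigroup using (x∙yz≈y∙xz)
open import Data.Nat.ListAction using (sum)
open import Data.Nat.ListAction.Properties using (sum-++)
open import Data.Nat.Tactic.RingSolver using (solve-∀)
open import Data.Bool.Properties using () renaming (_≟_ to _≟ᵇ_)
open import Data.Fin using (Fin; zero; suc; toℕ; _≟_)
import Data.Fin.Properties as Fin
open import Data.Fin.Subset using (Subset; Side; inside; outside; _∈_; _∉_; _⊆_; _∪_; _-_; ∣_∣; ⁅_⁆; ⊥; ⊤; Nonempty)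
open import Data.Fin.Subset.Properties
open import Data.List using (List; []; _∷_; length; map; filter; allFin; upTo; cartesianProductWith; cartesianProduct)
open import Data.List.Properties using (map-∘; map-++; map-tabulate; length-tabulate; length-upTo; length-map)
open import Data.List.Membership.Propositional using () renaming (_∈_ to _∈ₗ_)
open import Data.List.Membership.Propositional.Properties using (∈-upTo⁺; ∈-filter⁺; ∈-cartesianProduct⁺; ∈-allFin)
open import Data.List.Relation.Unary.All as All using (All; []; _∷_)
import Data.List.Relation.Unary.All.Properties as All
open import Data.List.Relation.Unary.AllPairs using ([]; _∷_)
open import Data.List.Relation.Unary.Any as Any using (Any; here; there)
open import Data.List.Relation.Unary.Unique.Propositional using (Unique)
import Data.List.Relation.Unary.Unique.Propositional.Properties as Unique
open import Data.Vec using (Vec; []; _∷_; here; there; lookup; _[_]≔_; replicate)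
open import Data.Vec.Properties using (lookup∘update; lookup∘update′; ≡-dec)
import Data.Integer as ℤ
import Data.Integer.Properties as ℤ
open import Data.Integer.Tactic.RingSolver using () renaming (solve-∀ to ℤ-solve-∀)
open import Data.Rational using (ℚ; 0ℚ; _<_; _≤_; _*_; _/_; toℚᵘ)
import Data.Rational as ℚ
import Data.Rational.Properties as ℚ
open import Data.Rational.Unnormalised using (mkℚᵘ; *≤*)
import Data.Rational.Unnormalised as ℚᵘ
import Data.Rational.Unnormalised.Properties as ℚᵘ
open import Data.Product using (Σ; ∃; _×_; _,_; proj₁; proj₂)
open import Data.Sum using (inj₁; inj₂)
open import Function using (_∘_; id)
open import Relation.Nullary using (¬_; Dec; yes; no; ¬?; _×-dec_; contradiction)
open import Relation.Binary.PropositionalEquality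

private variable
  A B : Set
  P P′ : Set
  m q r k : ℕ

-- Finite sums over lists and averaging.

∑ : List A → (A → ℕ) → ℕ
∑ xs f = sum (map f xs)

syntax ∑ xs (λ x → e) = ∑[ x ← xs ] e
infixr 8 ∑

∑-cong : ∀ (xs : List A) {f g} → (∀ x → f x ≡ g x) → ∑ xs f ≡ ∑ xs g
∑-cong []       f≗g = refl
∑-cong (x ∷ xs) f≗g = cong₂ _+_ (f≗g x) (∑-cong xs f≗g)

∑-monoᴬ : ∀ {xs : List A} {f g} → All (λ x → f x ≤ℕ g x) xs → ∑ xs f ≤ℕ ∑ xs g
∑-monoᴬ []        = z≤n
∑-monoᴬ (le ∷ ls) = ℕ.+-mono-≤ le (∑-monoᴬ ls)

∑-mono : ∀ (xs : List A) {f g} → (∀ x → f x ≤ℕ g x) → ∑ xs f ≤ℕ ∑ xs g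
∑-mono xs f≤g = ∑-monoᴬ (All.universal f≤g xs)

∑-+ : ∀ (xs : List A) f g → ∑[ x ← xs ] (f x + g x) ≡ ∑ xs f + ∑ xs g
∑-+ []       f g = refl
∑-+ (x ∷ xs) f g rewrite ∑-+ xs f g = lem (f x) (g x) (∑ xs f) (∑ xs g)
  where lem : ∀ a b c d → (a + b) + (c + d) ≡ (a + c) + (b + d)
        lem = solve-∀

∑-*ˡ : ∀ c (xs : List A) f → ∑[ x ← xs ] (c · f x) ≡ c · ∑ xs f
∑-*ˡ c []       f = sym (ℕ.*-zeroʳ c)
∑-*ˡ c (x ∷ xs) f rewrite ∑-*ˡ c xs f = sym (ℕ.*-distribˡ-+ c (f x) (∑ xs f))

∑-*ʳ : ∀ (xs : List A) f c → ∑[ x ← xs ] (f x · c) ≡ ∑ xs f · c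
∑-*ʳ xs f c = trans (∑-cong xs λ x → ℕ.*-comm (f x) c)
                    (trans (∑-*ˡ c xs f) (ℕ.*-comm c (∑ xs f)))

∑-const : ∀ (xs : List A) c → ∑[ _ ← xs ] c ≡ length xs · c
∑-const []       c = refl
∑-const (x ∷ xs) c = cong (λ z → c + z) (∑-const xs c)

∑-swap : ∀ (xs : List A) (ys : List B) (f : A → B → ℕ) →
         ∑[ x ← xs ] ∑[ y ← ys ] f x y ≡ ∑[ y ← ys ] ∑[ x ← xs ] f x y
∑-swap []       ys f = sym (trans (∑-const ys 0) (ℕ.*-zeroʳ (length ys)))
∑-swap (x ∷ xs) ys f = trans (cong (λ z → ∑ ys (f x) + z) (∑-swap xs ys f))
                             (sym (∑-+ ys (f x) _))

∑-cartesianProductWith : ∀ {C : Set} (h : A → B → C) xs ys f →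
  ∑ (cartesianProductWith h xs ys) f ≡ ∑[ x ← xs ] ∑[ y ← ys ] f (h x y)
∑-cartesianProductWith h []       ys f = refl
∑-cartesianProductWith h (x ∷ xs) ys f
  rewrite map-++ f (map (h x) ys) (cartesianProductWith h xs ys)
        | sum-++ (map f (map (h x) ys)) (map f (cartesianProductWith h xs ys))
        | sym (map-∘ {g = f} {f = h x} ys)
        | ∑-cartesianProductWith h xs ys f = refl

∑-allFin : ∀ n (f : Fin (suc n) → ℕ) →
           ∑ (allFin (suc n)) f ≡ f zero + ∑[ i ← allFin n ] f (suc i)
∑-allFin n f = cong (λ z → f zero + sum z)
  (trans (map-tabulate suc f) (sym (map-tabulate id (f ∘ suc))))

f[x]≤∑ : ∀ {x : A} {xs} f → x ∈ₗ xs → f x ≤ℕ ∑ xs f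
f[x]≤∑ f (here refl) = ℕ.m≤m+n _ _
f[x]≤∑ f (there x∈)  = ℕ.≤-trans (f[x]≤∑ f x∈) (ℕ.m≤n+m _ _)

∑<∑⇒∃< : ∀ (xs : List A) {f g} → ∑ xs f <ℕ ∑ xs g → ∃ λ x → f x <ℕ g x
∑<∑⇒∃< (x ∷ xs) {f} {g} lt with f x ℕ.<? g x
... | yes p = x , p
... | no ¬p = ∑<∑⇒∃< xs (ℕ.+-cancelˡ-< (f x) _ _
                (ℕ.<-≤-trans lt (ℕ.+-monoˡ-≤ _ (ℕ.≮⇒≥ ¬p))))

-- The first-moment method with weights `w`. Passing from `f` to `suc ∘ f` adds the positive total
-- weight, which turns the weak bound on the average into the strict one that `∑<∑⇒∃<` takes;
-- cancelling `w x` then leaves `t < suc (f x)`.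
∑≥⇒∃≥ : ∀ (xs : List A) (w f : A → ℕ) t → 0 <ℕ ∑ xs w →
        ∑ xs w · t ≤ℕ ∑[ x ← xs ] (w x · f x) → ∃ λ x → t ≤ℕ f x
∑≥⇒∃≥ xs w f t w>0 le = let x , lt = ∑<∑⇒∃< xs gap in
    x , ℕ.≤-pred (ℕ.*-cancelˡ-< (w x) _ _ lt)
  where
  open ℕ.≤-Reasoning
  gap : ∑[ x ← xs ] (w x · t) <ℕ ∑[ x ← xs ] (w x · suc (f x))
  gap = begin-strict
    ∑[ x ← xs ] (w x · t)             ≡⟨ ∑-*ʳ xs w t ⟩
    ∑ xs w · t                        ≤⟨ le ⟩
    ∑[ x ← xs ] (w x · f x)           <⟨ ℕ.m<n+m _ w>0 ⟩
    ∑ xs w + ∑[ x ← xs ] (w x · f x)  ≡⟨ ∑-+ xs w _ ⟨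
    ∑[ x ← xs ] (w x + w x · f x)     ≡⟨ ∑-cong xs (λ x → sym (ℕ.*-suc (w x) (f x))) ⟩
    ∑[ x ← xs ] (w x · suc (f x))     ∎

-- Indicators and cardinalities of subsets.

𝟙 : Dec P → ℕ
𝟙 (yes _) = 1
𝟙 (no  _) = 0

𝟙-yes : P → (d : Dec P) → 𝟙 d ≡ 1
𝟙-yes p (yes _) = refl
𝟙-yes p (no ¬p) = contradiction p ¬p

𝟙-mono : (P → P′) → (d : Dec P) (e : Dec P′) → 𝟙 d ≤ℕ 𝟙 e
𝟙-mono f (yes p) e = ℕ.≤-reflexive (sym (𝟙-yes (f p) e))
𝟙-mono f (no _)  e = z≤n

𝟙-cong : (P → P′) → (P′ → P) → (d : Dec P) (e : Dec P′) → 𝟙 d ≡ 𝟙 e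
𝟙-cong f g d e = ℕ.≤-antisym (𝟙-mono f d e) (𝟙-mono g e d)

length-filter : ∀ {P : A → Set} (P? : ∀ x → Dec (P x)) xs →
                length (filter P? xs) ≡ ∑[ x ← xs ] 𝟙 (P? x)
length-filter P? []       = refl
length-filter P? (x ∷ xs) with P? x
... | yes _ = cong suc (length-filter P? xs)
... | no  _ = length-filter P? xs

∑-𝟙∈ : (J : Subset m) → ∑[ x ← allFin m ] 𝟙 (x ∈? J) ≡ ∣ J ∣
∑-𝟙∈ []      = refl
∑-𝟙∈ (s ∷ J) = trans (∑-allFin _ (λ x → 𝟙 (x ∈? (s ∷ J))))
  (trans (cong₂ _+_ (hd s) (∑-cong (allFin _) λ i →
     𝟙-cong drop-there there (suc i ∈? (s ∷ J)) (i ∈? J)))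
   (trans (cong (λ z → cnt s + z) (∑-𝟙∈ J)) (tl s)))
  where
  cnt : Side → ℕ
  cnt inside  = 1
  cnt outside = 0
  hd : ∀ s → 𝟙 (zero ∈? (s ∷ J)) ≡ cnt s
  hd inside  = refl
  hd outside = refl
  tl : ∀ s → cnt s + ∣ J ∣ ≡ ∣ s ∷ J ∣
  tl inside  = refl
  tl outside = refl

∣p∣≡1+∣p-x∣ : ∀ {p : Subset m} {x} → x ∈ p → ∣ p ∣ ≡ suc ∣ p - x ∣
∣p∣≡1+∣p-x∣ {p = inside ∷ p}  {zero}  _  = cong (suc ∘ ∣_∣) (sym (p─⊥≡p p))
∣p∣≡1+∣p-x∣ {p = inside ∷ p}  {suc x} x∈ = cong suc (∣p∣≡1+∣p-x∣ (drop-there x∈))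
∣p∣≡1+∣p-x∣ {p = outside ∷ p} {suc x} x∈ = ∣p∣≡1+∣p-x∣ (drop-there x∈)

-- Were `x` still present, deleting it again would lower the cardinality, yet a second deletion
-- changes nothing.
x∉p-x : ∀ (p : Subset m) x → x ∉ p - x
x∉p-x p x x∈ = ℕ.<-irrefl refl
  (subst (λ z → ∣ z ∣ <ℕ ∣ p - x ∣) (p─q─q≡p─q p ⁅ x ⁆) (x∈p⇒∣p-x∣<∣p∣ {p = p - x} x∈))

x≢y∧x∈⁅y⁆∪p⇒x∈p : ∀ {p : Subset m} {x y} → x ≢ y → x ∈ ⁅ y ⁆ ∪ p → x ∈ p
x≢y∧x∈⁅y⁆∪p⇒x∈p {p = p} {x} {y} x≢y x∈ with x∈p∪q⁻ ⁅ y ⁆ p x∈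
... | inj₁ x∈y = contradiction (x∈⁅y⁆⇒x≡y y x∈y) x≢y
... | inj₂ x∈p = x∈p

x∈p⇒⁅x⁆∪p≡p : ∀ {p : Subset m} {x} → x ∈ p → ⁅ x ⁆ ∪ p ≡ p
x∈p⇒⁅x⁆∪p≡p {p = p} {x} x∈p = ⊆-antisym sub (λ y∈ → x∈p∪q⁺ (inj₂ y∈))
  where
  sub : ⁅ x ⁆ ∪ p ⊆ p
  sub {y} y∈ with x∈p∪q⁻ ⁅ x ⁆ p y∈
  ... | inj₁ y∈x = subst (_∈ p) (sym (x∈⁅y⁆⇒x≡y x y∈x)) x∈p
  ... | inj₂ y∈p = y∈p

∣p∣≡0⇒p≡⊥ : ∀ {p : Subset m} → ∣ p ∣ ≡ 0 → p ≡ ⊥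
∣p∣≡0⇒p≡⊥ {p = p} eq = Empty-unique λ { (x , x∈) → ℕ.n≮0 (subst (λ z → ∣ p - x ∣ <ℕ z) eq (x∈p⇒∣p-x∣<∣p∣ x∈)) }

-- Images of subsets.

-- The direct image of a subset. It recurses on the subset so that it consumes one colour at a time,
-- in step with `assignments`.
im : Subset m → (Fin m → Fin r) → Subset r
im []            f = ⊥
im (inside  ∷ C) f = ⁅ f zero ⁆ ∪ im C (f ∘ suc)
im (outside ∷ C) f = im C (f ∘ suc)

∈-im⁺ : ∀ (C : Subset m) (f : Fin m → Fin r) {i} → i ∈ C → f i ∈ im C f
∈-im⁺ (inside  ∷ C) f {zero}  i∈ = x∈p∪q⁺ (inj₁ (x∈⁅x⁆ (f zero)))
∈-im⁺ (inside  ∷ C) f {suc i} i∈ = x∈p∪q⁺ (inj₂ (∈-im⁺ C (f ∘ suc) (drop-there i∈)))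
∈-im⁺ (outside ∷ C) f {suc i} i∈ = ∈-im⁺ C (f ∘ suc) (drop-there i∈)

∈-im⁻ : ∀ (C : Subset m) (f : Fin m → Fin r) {j} → j ∈ im C f → ∃ λ i → i ∈ C × f i ≡ j
∈-im⁻ []            f j∈ = contradiction j∈ ∉⊥
∈-im⁻ (outside ∷ C) f j∈ with i , i∈ , eq ← ∈-im⁻ C (f ∘ suc) j∈ = suc i , there i∈ , eq
∈-im⁻ (inside  ∷ C) f j∈ with x∈p∪q⁻ ⁅ f zero ⁆ _ j∈
... | inj₁ j∈₁ = zero , here , sym (x∈⁅y⁆⇒x≡y _ j∈₁)
... | inj₂ j∈₂ with i , i∈ , eq ← ∈-im⁻ C (f ∘ suc) j∈₂ = suc i , there i∈ , eq

im-⊆ : ∀ {l} (C : Subset m) (f : Fin m → Fin r) (D : Subset l) (g : Fin l → Fin r) →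
       (∀ i → i ∈ C → ∃ λ j → j ∈ D × g j ≡ f i) → im C f ⊆ im D g
im-⊆ C f D g h j∈ with i , i∈ , refl ← ∈-im⁻ C f j∈ with j , j∈D , eq ← h i i∈ =
  subst (_∈ im D g) eq (∈-im⁺ D g j∈D)

∣im∣ : ∀ (C : Subset m) (f : Fin m → Fin r) →
       (∀ i j → i ∈ C → j ∈ C → i ≢ j → f i ≢ f j) → ∣ im C f ∣ ≡ ∣ C ∣
∣im∣ {r = r} []    f inj = ∣⊥∣≡0 r
∣im∣ (outside ∷ C) f inj = ∣im∣ C (f ∘ suc) λ i j i∈ j∈ i≢j →
  inj (suc i) (suc j) (there i∈) (there j∈) (i≢j ∘ Fin.suc-injective)
∣im∣ (inside ∷ C) f inj = begin
  ∣ ⁅ x ⁆ ∪ I ∣            ≡⟨ ∣p∣≡1+∣p-x∣ (x∈p∪q⁺ {p = ⁅ x ⁆} (inj₁ (x∈⁅x⁆ x))) ⟩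
  suc ∣ (⁅ x ⁆ ∪ I) - x ∣  ≡⟨ cong (suc ∘ ∣_∣) (⊆-antisym fwd bwd) ⟩
  suc ∣ I ∣                ≡⟨ cong suc (∣im∣ C (f ∘ suc) λ i j i∈ j∈ i≢j →
      inj (suc i) (suc j) (there i∈) (there j∈) (i≢j ∘ Fin.suc-injective)) ⟩
  suc ∣ C ∣                ∎
  where
  open ≡-Reasoning
  x = f zero
  I = im C (f ∘ suc)
  fwd : (⁅ x ⁆ ∪ I) - x ⊆ I
  fwd {y} y∈ = x≢y∧x∈⁅y⁆∪p⇒x∈p (λ { refl → x∉p-x (⁅ x ⁆ ∪ I) x y∈ }) (p─q⊆p _ ⁅ x ⁆ y∈)
  bwd : I ⊆ (⁅ x ⁆ ∪ I) - x
  bwd {y} y∈ with i , i∈ , refl ← ∈-im⁻ C (f ∘ suc) y∈ =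
    x∈p∧x≢y⇒x∈p-y (x∈p∪q⁺ (inj₂ y∈)) (inj (suc i) zero (there i∈) here λ ())

_≟ₛ_ : (p q : Subset m) → Dec (p ≡ q)
_≟ₛ_ = ≡-dec _≟ᵇ_

-- Given `x ∈ J`, the sets `J` and `J - x` differ and are the only `I` that `x` completes to `J`, so
-- the two indicators add without overlap. This is the one-colour step in counting assignments by
-- their image.
𝟙-⁅x⁆∪I : ∀ (I J : Subset r) x →
  𝟙 ((⁅ x ⁆ ∪ I) ≟ₛ J) ≡ 𝟙 (x ∈? J) · (𝟙 (I ≟ₛ J) + 𝟙 (I ≟ₛ (J - x)))
𝟙-⁅x⁆∪I I J x with (⁅ x ⁆ ∪ I) ≟ₛ J | x ∈? J
... | no  _    | no _ = refl
... | yes refl | no x∉ = contradiction (x∈p∪q⁺ (inj₁ (x∈⁅x⁆ x))) x∉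
... | yes eq | yes x∈ with I ≟ₛ J | I ≟ₛ (J - x)
...   | yes refl | no _     = refl
...   | no _     | yes refl = refl
...   | yes refl | yes eq′ = contradiction (subst (x ∈_) eq′ x∈) (x∉p-x I x)
...   | no I≢J | no I≢J-x with x ∈? I
...     | yes x∈I = contradiction (trans (sym (x∈p⇒⁅x⁆∪p≡p x∈I)) eq) I≢J
...     | no x∉I = contradiction (⊆-antisym fwd bwd) I≢J-x
  where fwd : I ⊆ J - x
        fwd {y} y∈ = x∈p∧x≢y⇒x∈p-y (subst (y ∈_) eq (x∈p∪q⁺ (inj₂ y∈))) (λ { refl → x∉I y∈ })
        bwd : J - x ⊆ I
        bwd {y} y∈ = x≢y∧x∈⁅y⁆∪p⇒x∈p (λ { refl → x∉p-x J x y∈ })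
                       (subst (y ∈_) (sym eq) (p─q⊆p J ⁅ x ⁆ y∈))
𝟙-⁅x⁆∪I I J x | no ne | yes x∈ with I ≟ₛ J | I ≟ₛ (J - x)
... | no _ | no _ = refl
... | yes refl | _ = contradiction (x∈p⇒⁅x⁆∪p≡p x∈) ne
... | no _ | yes refl = contradiction (⊆-antisym fwd bwd) ne
  where fwd : ⁅ x ⁆ ∪ (J - x) ⊆ J
        fwd {y} y∈ with x∈p∪q⁻ ⁅ x ⁆ (J - x) y∈
        ... | inj₁ y∈x = subst (_∈ J) (sym (x∈⁅y⁆⇒x≡y x y∈x)) x∈
        ... | inj₂ y∈′ = p─q⊆p J ⁅ x ⁆ y∈′
        bwd : J ⊆ ⁅ x ⁆ ∪ (J - x)
        bwd {y} y∈ with y ≟ x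
        ... | yes refl = x∈p∪q⁺ (inj₁ (x∈⁅x⁆ x))
        ... | no y≢x   = x∈p∪q⁺ (inj₂ (x∈p∧x≢y⇒x∈p-y y∈ y≢x))

-- Surjection numbers.

-- The number of surjections from a k-element set onto a j-element set.
surj : ℕ → ℕ → ℕ
surj k j = S k j · j !

-- Choose the value of the extra element in `j` ways; the other `k` elements then cover either all
-- `j` values or exactly the remaining `j - 1`. For `j = 0` the junk from `pred` is killed by the
-- factor `j`.
surj-suc : ∀ k j → surj (suc k) j ≡ j · (surj k j + surj k (pred j))
surj-suc k zero    = refl
surj-suc k (suc j) = lem (S k (suc j)) (S k j) (j !) j
  where lem : ∀ a b f j → (suc j · a + b) · (f + j · f) ≡ suc j · (a · (f + j · f) + b · f)
        lem = solve-∀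

S-pos : ∀ {k j} → 1 ≤ℕ j → j ≤ℕ k → 1 ≤ℕ S k j
S-pos {suc k} {suc zero}    _ _ = base k
  where base : ∀ k → 1 ≤ℕ S (suc k) 1
        base zero    = ℕ.≤-refl
        base (suc k) = ℕ.≤-trans (base k) (ℕ.≤-trans (ℕ.m≤m+n _ 0) (ℕ.m≤m+n _ _))
S-pos {suc k} {suc (suc j)} _ (s≤s j≤k) =
  ℕ.≤-trans (S-pos {k} {suc j} (s≤s z≤n) j≤k) (ℕ.m≤n+m _ _)

-- Both `S k j ≥ 1` and `j ! ≥ j` hold in this range. This bounds from below the surplus that a
-- matched pair contributes.
surj≥ : ∀ {k j} → 1 ≤ℕ j → j ≤ℕ k → j ≤ℕ surj k j
surj≥ {k} {suc j} 1≤j j≤k = begin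
  suc j                  ≤⟨ ℕ.m≤m*n (suc j) (j !) {{j ℕ.!≢0}} ⟩
  suc j !                ≤⟨ ℕ.m≤n*m (suc j !) (S k (suc j)) {{ℕ.>-nonZero (S-pos 1≤j j≤k)}} ⟩
  surj k (suc j)         ∎
  where open ℕ.≤-Reasoning

-- Uniform assignments of parts to colours.

assignments : ∀ r q → List (Vec (Fin r) q)
assignments r zero    = [] ∷ []
assignments r (suc q) = cartesianProductWith _∷_ (allFin r) (assignments r q)

∑-assignments : ∀ r q (F : Vec (Fin r) (suc q) → ℕ) →
  ∑ (assignments r (suc q)) F ≡ ∑[ x ← allFin r ] ∑[ v ← assignments r q ] F (x ∷ v)
∑-assignments r q F = ∑-cartesianProductWith _∷_ (allFin r) (assignments r q) F

∑-allFin-const : ∀ n c → ∑[ _ ← allFin n ] c ≡ n · c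
∑-allFin-const n c = trans (∑-const (allFin n) c) (cong (_· c) (length-tabulate {n = n} id))

∑-assignments-1 : ∀ r q → ∑[ _ ← assignments r q ] 1 ≡ r ^ q
∑-assignments-1 r zero    = refl
∑-assignments-1 r (suc q) = trans (∑-assignments r q (λ _ → 1))
  (trans (∑-cong (allFin r) λ _ → ∑-assignments-1 r q) (∑-allFin-const r (r ^ q)))

-- Induction over the colours: one outside `C` is free, one inside reproduces the recurrence
-- `surj-suc`. The target is an arbitrary `J` rather than `⊤` because the induction also visits
-- `J - x`. The powers of `r` clear the denominators of a probability.
∑-𝟙im : ∀ (C : Subset q) (J : Subset r) →
  r ^ ∣ C ∣ · ∑[ v ← assignments r q ] 𝟙 (im C (lookup v) ≟ₛ J) ≡ r ^ q · surj ∣ C ∣ ∣ J ∣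
∑-𝟙im {r = r} [] J with ⊥ ≟ₛ J
... | yes refl rewrite ∣⊥∣≡0 r = refl
... | no ⊥≢J with ∣ J ∣ in eq
...   | zero  = contradiction (sym (∣p∣≡0⇒p≡⊥ eq)) ⊥≢J
...   | suc _ = refl
∑-𝟙im {suc q} {r} (outside ∷ C) J = begin
  r ^ ∣ C ∣ · ∑ (assignments r (suc q)) (λ v → 𝟙 (im (outside ∷ C) (lookup v) ≟ₛ J))
    ≡⟨ cong (r ^ ∣ C ∣ ·_) (trans (∑-assignments r q _) (∑-allFin-const r N)) ⟩
  r ^ ∣ C ∣ · (r · N)  ≡⟨ x∙yz≈y∙xz (r ^ ∣ C ∣) r N ⟩
  r · (r ^ ∣ C ∣ · N)  ≡⟨ cong (r ·_) (∑-𝟙im C J) ⟩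
  r · (r ^ q · surj ∣ C ∣ ∣ J ∣) ≡⟨ ℕ.*-assoc r (r ^ q) _ ⟨
  r ^ suc q · surj ∣ C ∣ ∣ J ∣ ∎
  where
  open ≡-Reasoning
  N = ∑[ v ← assignments r q ] 𝟙 (im C (lookup v) ≟ₛ J)
∑-𝟙im {suc q} {r} (inside ∷ C) J = begin
  r · r ^ c · ∑ (assignments r (suc q)) (λ v → 𝟙 (im (inside ∷ C) (lookup v) ≟ₛ J))
    ≡⟨ cong (r · r ^ c ·_) (∑-assignments r q _) ⟩
  r · r ^ c · ∑[ x ← allFin r ] ∑[ v ← assignments r q ] 𝟙 ((⁅ x ⁆ ∪ im C (lookup v)) ≟ₛ J)
    ≡⟨ cong (r · r ^ c ·_) (∑-cong (allFin r) λ x →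
         trans (∑-cong (assignments r q) λ v → 𝟙-⁅x⁆∪I (im C (lookup v)) J x)
         (trans (∑-*ˡ (𝟙 (x ∈? J)) (assignments r q) _)
                (cong (𝟙 (x ∈? J) ·_) (∑-+ (assignments r q) _ _)))) ⟩
  r · r ^ c · ∑[ x ← allFin r ] (𝟙 (x ∈? J) · (N J + N (J - x)))
    ≡⟨ trans (ℕ.*-assoc r (r ^ c) _) (cong (r ·_) (sym (∑-*ˡ (r ^ c) (allFin r) _))) ⟩
  r · ∑[ x ← allFin r ] (r ^ c · (𝟙 (x ∈? J) · (N J + N (J - x))))
    ≡⟨ cong (r ·_) (trans (∑-cong (allFin r) term)
         (trans (∑-*ʳ (allFin r) _ _) (cong (λ z → z · (r ^ q · (surj c ∣ J ∣ + surj c (pred ∣ J ∣)))) (∑-𝟙∈ J)))) ⟩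
  r · (∣ J ∣ · (r ^ q · (surj c ∣ J ∣ + surj c (pred ∣ J ∣))))
    ≡⟨ lem r ∣ J ∣ (r ^ q) _ ⟩
  r ^ suc q · (∣ J ∣ · (surj c ∣ J ∣ + surj c (pred ∣ J ∣)))
    ≡⟨ cong (r ^ suc q ·_) (surj-suc c ∣ J ∣) ⟨
  r ^ suc q · surj (suc c) ∣ J ∣ ∎
  where
  open ≡-Reasoning
  c = ∣ C ∣
  N : Subset r → ℕ
  N J = ∑[ v ← assignments r q ] 𝟙 (im C (lookup v) ≟ₛ J)
  lem : ∀ a b c d → a · (b · (c · d)) ≡ a · c · (b · d)
  lem = solve-∀
  -- The summand depends on `x` only through `x ∈ J`, since every `J - x` has the same cardinality;
  -- summing over `x` therefore yields the factor `∣ J ∣`.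
  term : ∀ x → r ^ c · (𝟙 (x ∈? J) · (N J + N (J - x)))
             ≡ 𝟙 (x ∈? J) · (r ^ q · (surj c ∣ J ∣ + surj c (pred ∣ J ∣)))
  term x with x ∈? J
  ... | no _ = ℕ.*-zeroʳ (r ^ c)
  ... | yes x∈ = begin
    r ^ c · (N J + N (J - x) + 0)          ≡⟨ lem₁ (r ^ c) (N J) (N (J - x)) ⟩
    r ^ c · N J + r ^ c · N (J - x)        ≡⟨ cong₂ _+_ (∑-𝟙im C J) (∑-𝟙im C (J - x)) ⟩
    r ^ q · surj c ∣ J ∣ + r ^ q · surj c ∣ J - x ∣
      ≡⟨ cong (λ z → r ^ q · surj c ∣ J ∣ + r ^ q · surj c (pred z)) (∣p∣≡1+∣p-x∣ x∈) ⟨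
    r ^ q · surj c ∣ J ∣ + r ^ q · surj c (pred ∣ J ∣)
      ≡⟨ lem₂ (r ^ q) (surj c ∣ J ∣) _ ⟩
    r ^ q · (surj c ∣ J ∣ + surj c (pred ∣ J ∣)) + 0 ∎
    where
    lem₁ : ∀ a b c → a · (b + c + 0) ≡ a · b + a · c
    lem₁ = solve-∀
    lem₂ : ∀ a b c → a · b + a · c ≡ a · (b + c) + 0
    lem₂ = solve-∀

-- Independence of coordinates, tied and untied colours.

-- Redrawing one coordinate of a uniform assignment leaves it uniform: each result arises from `r`
-- old values of that coordinate.
resample : ∀ (b : Fin q) (F : Vec (Fin r) q → ℕ) →
  ∑[ v ← assignments r q ] ∑[ x ← allFin r ] F (v [ b ]≔ x) ≡ r · ∑ (assignments r q) F
resample {suc q} {r} zero F = begin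
  ∑[ v ← assignments r (suc q) ] ∑[ x ← allFin r ] F (v [ zero ]≔ x)
    ≡⟨ trans (∑-assignments r q _) (∑-allFin-const r _) ⟩
  r · ∑[ v ← assignments r q ] ∑[ x ← allFin r ] F (x ∷ v)
    ≡⟨ cong (r ·_) (∑-swap (assignments r q) (allFin r) _) ⟩
  r · ∑[ x ← allFin r ] ∑[ v ← assignments r q ] F (x ∷ v)
    ≡⟨ cong (r ·_) (∑-assignments r q F) ⟨
  r · ∑ (assignments r (suc q)) F ∎
  where open ≡-Reasoning
resample {suc q} {r} (suc b) F = begin
  ∑[ v ← assignments r (suc q) ] ∑[ x ← allFin r ] F (v [ suc b ]≔ x)
    ≡⟨ ∑-assignments r q _ ⟩
  ∑[ y ← allFin r ] ∑[ v ← assignments r q ] ∑[ x ← allFin r ] F (y ∷ v [ b ]≔ x)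
    ≡⟨ ∑-cong (allFin r) (λ y → resample b (λ v → F (y ∷ v))) ⟩
  ∑[ y ← allFin r ] (r · ∑[ v ← assignments r q ] F (y ∷ v))
    ≡⟨ ∑-*ˡ r (allFin r) _ ⟩
  r · ∑[ y ← allFin r ] ∑[ v ← assignments r q ] F (y ∷ v)
    ≡⟨ cong (r ·_) (∑-assignments r q F) ⟨
  r · ∑ (assignments r (suc q)) F ∎
  where open ≡-Reasoning

Indep : Fin q → (Vec (Fin r) q → ℕ) → Set
Indep b G = ∀ v x → G (v [ b ]≔ x) ≡ G v

Indep-· : ∀ {b : Fin q} {F G : Vec (Fin r) q → ℕ} →
          Indep b F → Indep b G → Indep b (λ v → F v · G v)
Indep-· i j v x = cong₂ _·_ (i v x) (j v x)

tie untie : Fin q → Fin q → Vec (Fin r) q → ℕ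
tie   a b v = 𝟙 (lookup v a ≟ lookup v b)
untie a b v = 𝟙 (¬? (lookup v a ≟ lookup v b))

tie-sym : ∀ (a b : Fin q) (v : Vec (Fin r) q) → tie a b v ≡ tie b a v
tie-sym a b v = 𝟙-cong sym sym (lookup v a ≟ lookup v b) (lookup v b ≟ lookup v a)

untie-indep : ∀ {a b c : Fin q} → a ≢ b → a ≢ c → Indep {r = r} a (untie b c)
untie-indep a≢b a≢c v x = cong₂ (λ y z → 𝟙 (¬? (y ≟ z)))
  (lookup∘update′ (≢-sym a≢b) v x) (lookup∘update′ (≢-sym a≢c) v x)

∑-untie+∑-tie : ∀ (a b : Fin q) (G : Vec (Fin r) q → ℕ) →
  ∑[ v ← assignments r q ] (untie a b v · G v) + ∑[ v ← assignments r q ] (tie a b v · G v)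
    ≡ ∑ (assignments r q) G
∑-untie+∑-tie {q} {r} a b G = trans
  (sym (∑-+ (assignments r q) (λ v → untie a b v · G v) (λ v → tie a b v · G v)))
  (∑-cong (assignments r q) pointwise)
  where
  pointwise : ∀ v → untie a b v · G v + tie a b v · G v ≡ G v
  pointwise v with lookup v a ≟ lookup v b
  ... | yes _ = ℕ.+-identityʳ (G v)
  ... | no  _ = trans (ℕ.+-identityʳ _) (ℕ.+-identityʳ (G v))

∑-𝟙≟ : ∀ (y : Fin r) → ∑[ x ← allFin r ] 𝟙 (y ≟ x) ≡ 1
∑-𝟙≟ {r} y = trans
  (∑-cong (allFin r) λ x → 𝟙-cong (λ { refl → x∈⁅x⁆ y }) (sym ∘ x∈⁅y⁆⇒x≡y y) (y ≟ x) (x ∈? ⁅ y ⁆))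
  (trans (∑-𝟙∈ ⁅ y ⁆) (∣⁅x⁆∣≡1 y))

-- With all other coordinates fixed, exactly one redrawn value at `b` agrees with the one at `a`,
-- and `G` does not notice the redraw. So tying has probability `1 / r`, independently of `G`.
∑-tieʳ : ∀ {a b : Fin q} (G : Vec (Fin r) q → ℕ) → a ≢ b → Indep b G →
  r · ∑[ v ← assignments r q ] (tie a b v · G v) ≡ ∑ (assignments r q) G
∑-tieʳ {q} {r} {a} {b} G a≢b G-indep = begin
  r · ∑[ v ← assignments r q ] (tie a b v · G v)
    ≡⟨ resample b (λ v → tie a b v · G v) ⟨
  ∑[ v ← assignments r q ] ∑[ x ← allFin r ] (tie a b (v [ b ]≔ x) · G (v [ b ]≔ x))
    ≡⟨ ∑-cong (assignments r q) (λ v → trans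
         (∑-cong (allFin r) λ x → cong₂ _·_
           (cong₂ (λ y z → 𝟙 (y ≟ z)) (lookup∘update′ a≢b v x) (lookup∘update b v x)) (G-indep v x))
         (trans (∑-*ʳ (allFin r) _ (G v))
           (trans (cong (_· G v) (∑-𝟙≟ (lookup v a))) (ℕ.*-identityˡ (G v))))) ⟩
  ∑ (assignments r q) G ∎
  where open ≡-Reasoning

∑-tieˡ : ∀ {a b : Fin q} (G : Vec (Fin r) q → ℕ) → a ≢ b → Indep a G →
  r · ∑[ v ← assignments r q ] (tie a b v · G v) ≡ ∑ (assignments r q) G
∑-tieˡ {q} {r} {a} {b} G a≢b G-indep = trans
  (cong (r ·_) (∑-cong (assignments r q) λ v → cong (_· G v) (tie-sym a b v)))
  (∑-tieʳ G (≢-sym a≢b) G-indep)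

-- Untying complements tying, hence has probability `p / suc p`. Having `suc p` parts and adding `H`
-- to both sides avoids subtraction.
∑-untie : ∀ {p} {a b : Fin q} (G : Vec (Fin (suc p)) q → ℕ) → a ≢ b → Indep b G →
  suc p · ∑[ v ← assignments (suc p) q ] (untie a b v · G v) ≡ p · ∑ (assignments (suc p) q) G
∑-untie {q} {p} {a} {b} G a≢b G-indep = ℕ.+-cancelʳ-≡ H _ _ (begin
  suc p · U + H          ≡⟨ cong (λ z → suc p · U + z) (∑-tieʳ G a≢b G-indep) ⟨
  suc p · U + suc p · T  ≡⟨ ℕ.*-distribˡ-+ (suc p) U T ⟨
  suc p · (U + T)        ≡⟨ cong (suc p ·_) (∑-untie+∑-tie a b G) ⟩
  suc p · H              ≡⟨ ℕ.+-comm H (p · H) ⟩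
  p · H + H              ∎)
  where
  open ≡-Reasoning
  H = ∑ (assignments (suc p) q) G
  U = ∑[ v ← assignments (suc p) q ] (untie a b v · G v)
  T = ∑[ v ← assignments (suc p) q ] (tie a b v · G v)

-- Covering all parts, and the effect of untying one pair.

onto : Subset q → Vec (Fin r) q → ℕ
onto C v = 𝟙 (im C (lookup v) ≟ₛ ⊤)

onto-mono : ∀ (C D : Subset q) (v w : Vec (Fin r) q) →
  (∀ i → i ∈ C → ∃ λ j → j ∈ D × lookup w j ≡ lookup v i) → onto C v ≤ℕ onto D w
onto-mono C D v w h = 𝟙-mono
  (λ eq → ⊆-antisym (⊆-max _) (subst (_⊆ im D (lookup w)) eq (im-⊆ C (lookup v) D (lookup w) h)))
  (im C (lookup v) ≟ₛ ⊤) (im D (lookup w) ≟ₛ ⊤)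

onto-indep : ∀ {b : Fin q} {C : Subset q} → b ∉ C → Indep {r = r} b (onto C)
onto-indep {b = b} {C} b∉C v x = ℕ.≤-antisym
  (onto-mono C C (v [ b ]≔ x) v λ i i∈ → i , i∈ , sym (same i i∈))
  (onto-mono C C v (v [ b ]≔ x) λ i i∈ → i , i∈ , same i i∈)
  where
  same : ∀ i → i ∈ C → lookup (v [ b ]≔ x) i ≡ lookup v i
  same i i∈ = lookup∘update′ {i = i} {j = b} (λ { refl → b∉C i∈ }) v x

onto-delete : ∀ (C : Subset q) b (v : Vec (Fin r) q) → onto (C - b) v ≤ℕ onto C v
onto-delete C b v = onto-mono (C - b) C v v λ i i∈ → i , p─q⊆p C ⁅ b ⁆ i∈ , refl

-- When `a` and `b` are tied, `a` supplies the part of `b`, so removing `b` from `C` loses no part;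
-- otherwise both sides vanish.
tie-onto-delete : ∀ {a b : Fin q} {C : Subset q} → a ≢ b → a ∈ C → (v : Vec (Fin r) q) →
  tie a b v · onto C v ≡ tie a b v · onto (C - b) v
tie-onto-delete {a = a} {b} {C} a≢b a∈C v with lookup v a ≟ lookup v b
... | no  _  = refl
... | yes va≡vb = cong (λ z → z + 0) (ℕ.≤-antisym (onto-mono C (C - b) v v move) (onto-delete C b v))
  where
  move : ∀ i → i ∈ C → ∃ λ j → j ∈ C - b × lookup v j ≡ lookup v i
  move i i∈ with i ≟ b
  ... | yes refl = a , x∈p∧x≢y⇒x∈p-y a∈C a≢b , va≡vb
  ... | no i≢b   = i , x∈p∧x≢y⇒x∈p-y i∈ i≢b , refl

∑-tie-onto : ∀ {a b : Fin q} (C : Subset q) (G : Vec (Fin r) q → ℕ) → a ≢ b → Indep a G → Indep b G →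
  r · ∑[ v ← assignments r q ] (tie a b v · (G v · onto C v)) ≤ℕ ∑[ v ← assignments r q ] (G v · onto C v)
∑-tie-onto {q} {r} {a} {b} C G a≢b G-a G-b with a ∈? C
... | no a∉C = ℕ.≤-reflexive (∑-tieˡ (λ v → G v · onto C v) a≢b (Indep-· G-a (onto-indep a∉C)))
... | yes a∈C = begin
  r · ∑[ v ← assignments r q ] (tie a b v · (G v · onto C v))
    ≡⟨ cong (r ·_) (∑-cong (assignments r q) λ v → trans (x∙yz≈y∙xz (tie a b v) (G v) (onto C v))
         (trans (cong (G v ·_) (tie-onto-delete a≢b a∈C v)) (x∙yz≈y∙xz (G v) (tie a b v) (onto (C - b) v)))) ⟩
  r · ∑[ v ← assignments r q ] (tie a b v · (G v · onto (C - b) v))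
    ≡⟨ ∑-tieʳ (λ v → G v · onto (C - b) v) a≢b (Indep-· G-b (onto-indep (x∉p-x C b))) ⟩
  ∑[ v ← assignments r q ] (G v · onto (C - b) v)
    ≤⟨ ∑-mono (assignments r q) (λ v → ℕ.*-monoʳ-≤ (G v) (onto-delete C b v)) ⟩
  ∑[ v ← assignments r q ] (G v · onto C v) ∎
  where
  open ℕ.≤-Reasoning

-- Tied assignments cover at most at the overall rate, so the complementary untied ones cover at
-- least at that rate.
∑-untie-onto : ∀ {p} {a b : Fin q} (C : Subset q) (G : Vec (Fin (suc p)) q → ℕ) →
  a ≢ b → Indep a G → Indep b G →
  p · ∑[ v ← assignments (suc p) q ] (G v · onto C v)
    ≤ℕ suc p · ∑[ v ← assignments (suc p) q ] (untie a b v · (G v · onto C v))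
∑-untie-onto {q} {p} {a} {b} C G a≢b G-a G-b = ℕ.+-cancelˡ-≤ H _ _ (begin
  H + p · H              ≡⟨ cong (suc p ·_) (∑-untie+∑-tie a b _) ⟨
  suc p · (U + T)        ≡⟨ ℕ.*-distribˡ-+ (suc p) U T ⟩
  suc p · U + suc p · T  ≤⟨ ℕ.+-monoʳ-≤ (suc p · U) (∑-tie-onto C G a≢b G-a G-b) ⟩
  suc p · U + H          ≡⟨ ℕ.+-comm (suc p · U) H ⟩
  H + suc p · U          ∎)
  where
  open ℕ.≤-Reasoning
  H = ∑[ v ← assignments (suc p) q ] (G v · onto C v)
  U = ∑[ v ← assignments (suc p) q ] (untie a b v · (G v · onto C v))
  T = ∑[ v ← assignments (suc p) q ] (tie a b v · (G v · onto C v))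

∑-onto : ∀ (C : Subset q) →
  r ^ ∣ C ∣ · ∑ (assignments r q) (onto C) ≡ r ^ q · surj ∣ C ∣ r
∑-onto {q} {r} C = trans (∑-𝟙im C ⊤) (cong (λ z → r ^ q · surj ∣ C ∣ z) (∣⊤∣≡n r))

-- Tied colours act as one, so the loss from tying is governed by surj (∣ C ∣ - 1) (suc p); by surj-suc the
-- untied assignments keep the surplus suc p · surj (∣ C ∣ - 1) p, which is at least p.
∑-untie-onto-gain : ∀ {p} {a b : Fin q} (C : Subset q) → 1 ≤ℕ p → suc p ≤ℕ ∣ C ∣ →
  a ≢ b → a ∈ C → b ∈ C →
  p · (suc p ^ q · (surj ∣ C ∣ (suc p) + 1))
    ≤ℕ suc p · (suc p ^ ∣ C ∣ · ∑[ v ← assignments (suc p) q ] (untie a b v · onto C v))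
∑-untie-onto-gain {q} {p} {a} {b} C 1≤p R≤c a≢b a∈C b∈C = ℕ.+-cancelʳ-≤ (R · (Rq · s)) _ _ (begin
  p · (Rq · (surj c R + 1)) + R · (Rq · s)
    ≡⟨ lem₁ p Rq (surj c R) (R · (Rq · s)) ⟩
  p · (Rq · surj c R) + (Rq · p + R · (Rq · s))
    ≤⟨ ℕ.+-monoʳ-≤ (p · (Rq · surj c R)) (ℕ.+-monoˡ-≤ (R · (Rq · s)) (ℕ.*-monoʳ-≤ Rq p≤Rs′)) ⟩
  p · (Rq · surj c R) + (Rq · (R · s′) + R · (Rq · s))
    ≡⟨ lem₂ (p · (Rq · surj c R)) Rq R s s′ ⟩
  p · (Rq · surj c R) + Rq · (R · (s + s′))
    ≡⟨ cong (λ z → p · (Rq · surj c R) + Rq · z) surj-c ⟨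
  p · (Rq · surj c R) + Rq · surj c R
    ≡⟨ ℕ.+-comm _ (Rq · surj c R) ⟩
  R · (Rq · surj c R)
    ≡⟨ cong (R ·_) (∑-onto C) ⟨
  R · (Rc · O)
    ≡⟨ cong (λ z → R · (Rc · z)) (∑-untie+∑-tie a b (onto C)) ⟨
  R · (Rc · (U + T))
    ≡⟨ lem₃ R Rc U T ⟩
  R · (Rc · U) + Rc · (R · T)
    ≡⟨ cong (λ z → R · (Rc · U) + z) Rc-RT ⟩
  R · (Rc · U) + R · (Rq · s) ∎)
  where
  open ℕ.≤-Reasoning
  R = suc p
  c = ∣ C ∣
  c′ = ∣ C - b ∣
  s = surj c′ R
  s′ = surj c′ p
  Rq = R ^ q
  Rc = R ^ c
  O = ∑ (assignments R q) (onto C)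
  U = ∑[ v ← assignments R q ] (untie a b v · onto C v)
  T = ∑[ v ← assignments R q ] (tie a b v · onto C v)
  c≡ : c ≡ suc c′
  c≡ = ∣p∣≡1+∣p-x∣ b∈C
  surj-c : surj c R ≡ R · (s + s′)
  surj-c = trans (cong (λ z → surj z R) c≡) (surj-suc c′ R)
  p≤Rs′ : p ≤ℕ R · s′
  p≤Rs′ = ℕ.≤-trans (surj≥ 1≤p (ℕ.≤-pred (subst (suc p ≤ℕ_) c≡ R≤c))) (ℕ.m≤n*m s′ R)
  RT : R · T ≡ ∑ (assignments R q) (onto (C - b))
  RT = trans (cong (R ·_) (∑-cong (assignments R q) (tie-onto-delete a≢b a∈C)))
             (∑-tieʳ (onto (C - b)) a≢b (onto-indep (x∉p-x C b)))
  Rc-RT : Rc · (R · T) ≡ R · (Rq · s)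
  Rc-RT = trans (cong₂ _·_ (cong (R ^_) c≡) RT) (trans (ℕ.*-assoc R (R ^ c′) _) (cong (R ·_) (∑-onto (C - b))))
  lem₁ : ∀ a b c d → a · (b · (c + 1)) + d ≡ a · (b · c) + (b · a + d)
  lem₁ = solve-∀
  lem₂ : ∀ a b c d e → a + (b · (c · e) + c · (b · d)) ≡ a + b · (c · (d + e))
  lem₂ = solve-∀
  lem₃ : ∀ a b c d → a · (b · (c + d)) ≡ a · (b · c) + b · (a · d)
  lem₃ = solve-∀

-- Conditioning on a matching of colours.

Pair : ℕ → Set
Pair q = Fin q × Fin q

Avoids : Fin q → Pair q → Set
Avoids a (c , d) = a ≢ c × a ≢ d

Apart : Pair q → Pair q → Set
Apart (a , b) e = Avoids a e × Avoids b e

-- Pairwise disjoint pairs with distinct ends. `add` keeps the head disjoint from the whole tail,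
-- which makes the weight of the tail independent of both head colours.
data Matching {q} : List (Pair q) → Set where
  []  : Matching []
  add : ∀ {a b M} → a ≢ b → All (Apart (a , b)) M → Matching M → Matching ((a , b) ∷ M)

-- The indicator that every listed pair is untied; sums weighted by it are unnormalised expectations
-- conditioned on the matching.
weight : List (Pair q) → Vec (Fin r) q → ℕ
weight []            v = 1
weight ((a , b) ∷ M) v = untie a b v · weight M v

weight-indep : ∀ {a : Fin q} {M} → All (Avoids a) M → Indep {r = r} a (weight M)
weight-indep []                    v x = refl
weight-indep ((a≢c , a≢d) ∷ avoid) v x =
  cong₂ _·_ (untie-indep a≢c a≢d v x) (weight-indep avoid v x)

-- By disjointness each pair keeps a fraction `p / suc p` of the assignments left by the others.
∑-weight : ∀ {p} {M : List (Pair q)} → Matching M →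
  suc p ^ length M · ∑ (assignments (suc p) q) (weight M) ≡ p ^ length M · suc p ^ q
∑-weight {q} {p} [] = cong (_+ 0) (∑-assignments-1 (suc p) q)
∑-weight {q} {p} {_ ∷ M} (add {a} {b} a≢b apart match) = begin
  suc p · suc p ^ length M · ∑ (assignments (suc p) q) (weight ((a , b) ∷ M))
    ≡⟨ lem₁ (suc p) (suc p ^ length M) _ ⟩
  suc p ^ length M · (suc p · ∑ (assignments (suc p) q) (weight ((a , b) ∷ M)))
    ≡⟨ cong (suc p ^ length M ·_) (∑-untie (weight M) a≢b (weight-indep (All.map proj₂ apart))) ⟩
  suc p ^ length M · (p · ∑ (assignments (suc p) q) (weight M))
    ≡⟨ x∙yz≈y∙xz (suc p ^ length M) p _ ⟩
  p · (suc p ^ length M · ∑ (assignments (suc p) q) (weight M))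
    ≡⟨ cong (p ·_) (∑-weight match) ⟩
  p · (p ^ length M · suc p ^ q)
    ≡⟨ ℕ.*-assoc p (p ^ length M) _ ⟨
  p · p ^ length M · suc p ^ q ∎
  where
  open ≡-Reasoning
  lem₁ : ∀ a b c → a · b · c ≡ b · (a · c)
  lem₁ = solve-∀

-- Pairs are imposed one at a time by `∑-untie-onto`. The factor `X` allows a constraint disjoint
-- from `M` to be in force already, as when the pair that yields the gain comes first.
∑-weight-onto : ∀ {p} {M : List (Pair q)} (C : Subset q) (X : Vec (Fin (suc p)) q → ℕ) →
  Matching M → All (λ e → Indep (proj₁ e) X × Indep (proj₂ e) X) M →
  p ^ length M · ∑[ v ← assignments (suc p) q ] (X v · onto C v)
    ≤ℕ suc p ^ length M · ∑[ v ← assignments (suc p) q ] (weight M v · X v · onto C v)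
∑-weight-onto {q} {p} C X [] [] = ℕ.≤-reflexive (cong (_+ 0)
  (∑-cong (assignments (suc p) q) λ v → cong (_· onto C v) (sym (ℕ.*-identityˡ (X v)))))
∑-weight-onto {q} {p} {_ ∷ M} C X (add {a} {b} a≢b apart match) ((Xa , Xb) ∷ Xs) = begin
  p · p ^ T · ∑[ v ← assignments R q ] (X v · onto C v)
    ≡⟨ ℕ.*-assoc p (p ^ T) _ ⟩
  p · (p ^ T · ∑[ v ← assignments R q ] (X v · onto C v))
    ≤⟨ ℕ.*-monoʳ-≤ p (∑-weight-onto C X match Xs) ⟩
  p · (R ^ T · ∑[ v ← assignments R q ] (weight M v · X v · onto C v))
    ≡⟨ x∙yz≈y∙xz p (R ^ T) _ ⟩
  R ^ T · (p · ∑[ v ← assignments R q ] (weight M v · X v · onto C v))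
    ≤⟨ ℕ.*-monoʳ-≤ (R ^ T) (∑-untie-onto C (λ v → weight M v · X v) a≢b
         (Indep-· (weight-indep (All.map proj₁ apart)) Xa) (Indep-· (weight-indep (All.map proj₂ apart)) Xb)) ⟩
  R ^ T · (R · ∑[ v ← assignments R q ] (untie a b v · (weight M v · X v · onto C v)))
    ≡⟨ lem₂ (R ^ T) R _ ⟩
  R · R ^ T · ∑[ v ← assignments R q ] (untie a b v · (weight M v · X v · onto C v))
    ≡⟨ cong (R · R ^ T ·_) (∑-cong (assignments R q) λ v →
         lem₃ (untie a b v) (weight M v) (X v) (onto C v)) ⟩
  R · R ^ T · ∑[ v ← assignments R q ] (untie a b v · weight M v · X v · onto C v) ∎
  where
  open ℕ.≤-Reasoning
  R = suc p
  T = length M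
  lem₂ : ∀ a b c → a · (b · c) ≡ b · a · c
  lem₂ = solve-∀
  lem₃ : ∀ a b c d → a · (b · c · d) ≡ a · b · c · d
  lem₃ = solve-∀

Hits : List (Pair q) → Subset q → Set
Hits M C = Any (λ e → proj₁ e ∈ C × proj₂ e ∈ C) M

hits? : ∀ (M : List (Pair q)) C → Dec (Hits M C)
hits? M C = Any.any? (λ e → (proj₁ e ∈? C) ×-dec (proj₂ e ∈? C)) M

-- The pair inside `C` is imposed first and yields the gain. The pairs behind it in the list follow
-- by `∑-weight-onto` with `X = untie a b`, those in front of it by `∑-untie-onto`; neither loses
-- anything.
∑-weight-onto-gain : ∀ {p} {M : List (Pair q)} (C : Subset q) → 1 ≤ℕ p → suc p ≤ℕ ∣ C ∣ →
  Matching M → Hits M C →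
  p ^ length M · (suc p ^ q · (surj ∣ C ∣ (suc p) + 1))
    ≤ℕ suc p ^ length M · (suc p ^ ∣ C ∣ · ∑[ v ← assignments (suc p) q ] (weight M v · onto C v))
∑-weight-onto-gain {q} {p} {_ ∷ M} C 1≤p R≤c (add {a} {b} a≢b apart match) (here (a∈C , b∈C)) = begin
  p · p ^ T · Z                ≡⟨ lem₁ p (p ^ T) Z ⟩
  p ^ T · (p · Z)              ≤⟨ ℕ.*-monoʳ-≤ (p ^ T) (∑-untie-onto-gain C 1≤p R≤c a≢b a∈C b∈C) ⟩
  p ^ T · (R · (Rc · ∑[ v ← assignments R q ] (untie a b v · onto C v)))
    ≡⟨ lem₂ (p ^ T) R Rc _ ⟩
  R · Rc · (p ^ T · ∑[ v ← assignments R q ] (untie a b v · onto C v))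
    ≤⟨ ℕ.*-monoʳ-≤ (R · Rc) (∑-weight-onto C (untie a b) match (All.map indep apart)) ⟩
  R · Rc · (R ^ T · ∑[ v ← assignments R q ] (weight M v · untie a b v · onto C v))
    ≡⟨ lem₃ R Rc (R ^ T) _ ⟩
  R · R ^ T · (Rc · ∑[ v ← assignments R q ] (weight M v · untie a b v · onto C v))
    ≡⟨ cong (λ z → R · R ^ T · (Rc · z)) (∑-cong (assignments R q) λ v →
         cong (_· onto C v) (ℕ.*-comm (weight M v) (untie a b v))) ⟩
  R · R ^ T · (Rc · ∑[ v ← assignments R q ] (untie a b v · weight M v · onto C v)) ∎
  where
  open ℕ.≤-Reasoning
  R = suc p
  T = length M
  Rc = R ^ ∣ C ∣
  Z = R ^ q · (surj ∣ C ∣ R + 1)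
  indep : ∀ {e} → Apart (a , b) e → Indep {r = R} (proj₁ e) (untie a b) × Indep {r = R} (proj₂ e) (untie a b)
  indep ((a≢c , a≢d) , (b≢c , b≢d)) =
    untie-indep (≢-sym a≢c) (≢-sym b≢c) , untie-indep (≢-sym a≢d) (≢-sym b≢d)
  lem₁ : ∀ a b c → a · b · c ≡ b · (a · c)
  lem₁ = solve-∀
  lem₂ : ∀ a b c d → a · (b · (c · d)) ≡ b · c · (a · d)
  lem₂ = solve-∀
  lem₃ : ∀ a b c d → a · b · (c · d) ≡ a · c · (b · d)
  lem₃ = solve-∀
∑-weight-onto-gain {q} {p} {_ ∷ M} C 1≤p R≤c (add {a} {b} a≢b apart match) (there hit) = begin
  p · p ^ T · Z                ≡⟨ ℕ.*-assoc p (p ^ T) Z ⟩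
  p · (p ^ T · Z)              ≤⟨ ℕ.*-monoʳ-≤ p (∑-weight-onto-gain C 1≤p R≤c match hit) ⟩
  p · (R ^ T · (Rc · ∑[ v ← assignments R q ] (weight M v · onto C v)))
    ≡⟨ lem₁ p (R ^ T) Rc _ ⟩
  R ^ T · Rc · (p · ∑[ v ← assignments R q ] (weight M v · onto C v))
    ≤⟨ ℕ.*-monoʳ-≤ (R ^ T · Rc) (∑-untie-onto C (weight M) a≢b
         (weight-indep (All.map proj₁ apart)) (weight-indep (All.map proj₂ apart))) ⟩
  R ^ T · Rc · (R · ∑[ v ← assignments R q ] (untie a b v · (weight M v · onto C v)))
    ≡⟨ lem₂ (R ^ T) Rc R _ ⟩
  R · R ^ T · (Rc · ∑[ v ← assignments R q ] (untie a b v · (weight M v · onto C v)))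
    ≡⟨ cong (λ z → R · R ^ T · (Rc · z)) (∑-cong (assignments R q) λ v →
         sym (ℕ.*-assoc (untie a b v) (weight M v) (onto C v))) ⟩
  R · R ^ T · (Rc · ∑[ v ← assignments R q ] (untie a b v · weight M v · onto C v)) ∎
  where
  open ℕ.≤-Reasoning
  R = suc p
  T = length M
  Rc = R ^ ∣ C ∣
  Z = R ^ q · (surj ∣ C ∣ R + 1)
  lem₁ : ∀ a b c d → a · (b · (c · d)) ≡ b · c · (a · d)
  lem₁ = solve-∀
  lem₂ : ∀ a b c d → a · b · (c · d) ≡ c · a · (b · d)
  lem₂ = solve-∀

-- Puts hit and unhit colour sets under one bound, so that it can be summed over all edges; without
-- a hit, `X = 1` gives the plain average.
∑-weight-onto-𝟙 : ∀ {p} {M : List (Pair q)} (C : Subset q) → 1 ≤ℕ p → suc p ≤ℕ ∣ C ∣ → Matching M →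
  p ^ length M · (suc p ^ q · (surj ∣ C ∣ (suc p) + 𝟙 (hits? M C)))
    ≤ℕ suc p ^ length M · (suc p ^ ∣ C ∣ · ∑[ v ← assignments (suc p) q ] (weight M v · onto C v))
∑-weight-onto-𝟙 {q} {p} {M} C 1≤p R≤c match with hits? M C
... | yes hit = ∑-weight-onto-gain C 1≤p R≤c match hit
... | no  _   = begin
  p ^ T · (R ^ q · (surj c R + 0))  ≡⟨ cong (λ z → p ^ T · (R ^ q · z)) (ℕ.+-identityʳ (surj c R)) ⟩
  p ^ T · (R ^ q · surj c R)        ≡⟨ cong (p ^ T ·_) (∑-onto C) ⟨
  p ^ T · (R ^ c · ∑ (assignments R q) (onto C))  ≡⟨ x∙yz≈y∙xz (p ^ T) (R ^ c) _ ⟩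
  R ^ c · (p ^ T · ∑ (assignments R q) (onto C))
    ≡⟨ cong (λ z → R ^ c · (p ^ T · z)) (∑-cong (assignments R q) λ v → sym (ℕ.+-identityʳ (onto C v))) ⟩
  R ^ c · (p ^ T · ∑[ v ← assignments R q ] (1 · onto C v))
    ≤⟨ ℕ.*-monoʳ-≤ (R ^ c) (∑-weight-onto C (λ _ → 1) match (All.universal (λ _ → (λ _ _ → refl) , λ _ _ → refl) M)) ⟩
  R ^ c · (R ^ T · ∑[ v ← assignments R q ] (weight M v · 1 · onto C v))
    ≡⟨ cong (λ z → R ^ c · (R ^ T · z)) (∑-cong (assignments R q) λ v →
         cong (_· onto C v) (ℕ.*-identityʳ (weight M v))) ⟩
  R ^ c · (R ^ T · ∑[ v ← assignments R q ] (weight M v · onto C v))  ≡⟨ x∙yz≈y∙xz (R ^ c) (R ^ T) _ ⟩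
  R ^ T · (R ^ c · ∑[ v ← assignments R q ] (weight M v · onto C v))  ∎
  where
  open ℕ.≤-Reasoning
  R = suc p
  T = length M
  c = ∣ C ∣

-- Matchings of colours with a fixed sum.

-- A fixed sum determines the partner of each colour; the order excludes `(a , a)` and lists each
-- pair only once.
SumsTo : ℕ → Pair q → Set
SumsTo s (a , b) = toℕ a <ℕ toℕ b × toℕ a + toℕ b ≡ s

sumsTo? : ∀ s (e : Pair q) → Dec (SumsTo s e)
sumsTo? s (a , b) = (toℕ a ℕ.<? toℕ b) ×-dec (toℕ a + toℕ b ℕ.≟ s)

-- With equal sums, a colour shared in the same position makes the pairs equal, and one shared
-- crosswise makes them reversals of each other, which cannot both be increasing.
sumsTo⇒apart : ∀ {s} {e e′ : Pair q} → SumsTo s e → SumsTo s e′ → e ≢ e′ → Apart e e′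
sumsTo⇒apart {e = a , b} {c , d} (a<b , a+b≡s) (c<d , c+d≡s) e≢e′ =
  (a≢c , a≢d) , (b≢c , b≢d)
  where
  a+b≡c+d : toℕ a + toℕ b ≡ toℕ c + toℕ d
  a+b≡c+d = trans a+b≡s (sym c+d≡s)
  a≢c : a ≢ c
  a≢c refl = e≢e′ (cong (a ,_) (Fin.toℕ-injective (ℕ.+-cancelˡ-≡ (toℕ a) _ _ a+b≡c+d)))
  b≢d : b ≢ d
  b≢d refl = e≢e′ (cong (_, b) (Fin.toℕ-injective (ℕ.+-cancelʳ-≡ (toℕ b) _ _ a+b≡c+d)))
  a≢d : a ≢ d
  a≢d refl = ℕ.<-asym a<b (subst (_<ℕ toℕ a) (sym b≡c) c<d)
    where b≡c : toℕ b ≡ toℕ c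
          b≡c = ℕ.+-cancelˡ-≡ (toℕ a) _ _ (trans a+b≡c+d (ℕ.+-comm (toℕ c) (toℕ a)))
  b≢c : b ≢ c
  b≢c refl = ℕ.<-asym a<b (subst (toℕ b <ℕ_) (sym a≡d) c<d)
    where a≡d : toℕ a ≡ toℕ d
          a≡d = ℕ.+-cancelʳ-≡ (toℕ b) _ _ (trans a+b≡c+d (ℕ.+-comm (toℕ b) (toℕ d)))

sumsTo⇒matching : ∀ {s} {M : List (Pair q)} → Unique M → All (SumsTo s) M → Matching M
sumsTo⇒matching [] [] = []
sumsTo⇒matching (new ∷ uniq) (sum@(a<b , _) ∷ sums) = add
  (λ a≡b → ℕ.<⇒≢ a<b (cong toℕ a≡b))
  (All.zipWith (λ (sum′ , e≢e′) → sumsTo⇒apart sum sum′ e≢e′) (sums , new))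
  (sumsTo⇒matching uniq sums)

pairs : ∀ q → ℕ → List (Pair q)
pairs q s = filter (sumsTo? s) (cartesianProduct (allFin q) (allFin q))

pairs-matching : ∀ q s → Matching (pairs q s)
pairs-matching q s = sumsTo⇒matching
  (Unique.filter⁺ (sumsTo? s) (Unique.cartesianProduct⁺ (Unique.allFin⁺ q) (Unique.allFin⁺ q)))
  (All.all-filter (sumsTo? s) (cartesianProduct (allFin q) (allFin q)))

nonempty : ∀ {C : Subset q} → 1 ≤ℕ ∣ C ∣ → Nonempty C
nonempty {C = inside  ∷ C} _ = zero , here
nonempty {C = outside ∷ C} h with i , i∈ ← nonempty {C = C} h = suc i , there i∈

two-elements : ∀ {C : Subset q} → 2 ≤ℕ ∣ C ∣ → ∃ λ a → ∃ λ b → a ∈ C × b ∈ C × toℕ a <ℕ toℕ b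
two-elements {C = inside  ∷ C} (s≤s h) with i , i∈ ← nonempty {C = C} h =
  zero , suc i , here , there i∈ , s≤s z≤n
two-elements {C = outside ∷ C} h with a , b , a∈ , b∈ , a<b ← two-elements {C = C} h =
  suc a , suc b , there a∈ , there b∈ , s≤s a<b

-- Two colours of `C` have a sum below `q + q`, and the matching for that sum contains their pair.
∑-hits : ∀ {C : Subset q} → 2 ≤ℕ ∣ C ∣ → 1 ≤ℕ ∑[ s ← upTo (q + q) ] 𝟙 (hits? (pairs q s) C)
∑-hits {q} {C} h with a , b , a∈ , b∈ , a<b ← two-elements {C = C} h =
  subst (_≤ℕ ∑[ s ← upTo (q + q) ] 𝟙 (hits? (pairs q s) C)) (𝟙-yes hit (hits? (pairs q s₀) C))
    (f[x]≤∑ (λ s → 𝟙 (hits? (pairs q s) C)) (∈-upTo⁺ (ℕ.+-mono-< (Fin.toℕ<n a) (Fin.toℕ<n b))))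
  where
  s₀ = toℕ a + toℕ b
  ab∈ : (a , b) ∈ₗ pairs q s₀
  ab∈ = ∈-filter⁺ (sumsTo? s₀) (∈-cartesianProduct⁺ (∈-allFin a) (∈-allFin b)) (a<b , refl)
  hit : Hits (pairs q s₀) C
  hit = Any.map (λ { refl → a∈ , b∈ }) ab∈

-- Choosing the matching and the assignment by averaging.

-- The edgewise bounds add up to a bound on the conditional expectation of the number of covered
-- sets, and some assignment attains at least the expectation.
matching-assignment : ∀ {p} {M : List (Pair q)} {Cs : List (Subset q)} →
  1 ≤ℕ p → suc p ≤ℕ k → Matching M → All (λ C → ∣ C ∣ ≡ k) Cs →
  ∃ λ (v : Vec (Fin (suc p)) q) →
    length Cs · surj k (suc p) + ∑[ C ← Cs ] 𝟙 (hits? M C) ≤ℕ suc p ^ k · ∑[ C ← Cs ] onto C v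
matching-assignment {q} {k} {p} {M} {Cs} 1≤p R≤k match sizes =
  ∑≥⇒∃≥ V (weight M) (λ v → R ^ k · ∑[ C ← Cs ] onto C v) t W>0
    -- The factor `R ^ T` turns the total weight into `p ^ T · R ^ q`, the normalisation used by the
    -- edgewise bounds.
    (ℕ.*-cancelˡ-≤ (R ^ T) {{ℕ.m^n≢0 R T}} (begin
      R ^ T · (∑ V (weight M) · t)   ≡⟨ ℕ.*-assoc (R ^ T) _ t ⟨
      R ^ T · ∑ V (weight M) · t     ≡⟨ cong (_· t) (∑-weight match) ⟩
      p ^ T · R ^ q · t              ≡⟨ ℕ.*-assoc (p ^ T) (R ^ q) t ⟩
      p ^ T · (R ^ q · t)            ≡⟨ cong (λ z → p ^ T · (R ^ q · z)) t≡ ⟩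
      p ^ T · (R ^ q · ∑[ C ← Cs ] (surj k R + 𝟙 (hits? M C)))
        ≡⟨ trans (∑-*ˡ (p ^ T) Cs _) (cong (p ^ T ·_) (∑-*ˡ (R ^ q) Cs _)) ⟨
      ∑[ C ← Cs ] (p ^ T · (R ^ q · (surj k R + 𝟙 (hits? M C))))
        ≤⟨ ∑-monoᴬ (All.map (λ { {C} refl → ∑-weight-onto-𝟙 C 1≤p R≤k match }) sizes) ⟩
      ∑[ C ← Cs ] (R ^ T · (R ^ k · ∑[ v ← V ] (weight M v · onto C v)))
        ≡⟨ trans (∑-*ˡ (R ^ T) Cs _) (cong (R ^ T ·_) (∑-*ˡ (R ^ k) Cs _)) ⟩
      R ^ T · (R ^ k · ∑[ C ← Cs ] ∑[ v ← V ] (weight M v · onto C v))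
        ≡⟨ cong (λ z → R ^ T · (R ^ k · z)) (trans (∑-swap Cs V _) (∑-cong V λ v → ∑-*ˡ (weight M v) Cs _)) ⟩
      R ^ T · (R ^ k · ∑[ v ← V ] (weight M v · ∑[ C ← Cs ] onto C v))
        ≡⟨ cong (R ^ T ·_) (trans (sym (∑-*ˡ (R ^ k) V _))
             (∑-cong V λ v → x∙yz≈y∙xz (R ^ k) (weight M v) (∑[ C ← Cs ] onto C v))) ⟩
      R ^ T · ∑[ v ← V ] (weight M v · (R ^ k · ∑[ C ← Cs ] onto C v)) ∎))
  where
  open ℕ.≤-Reasoning
  R = suc p
  T = length M
  V = assignments R q
  t = length Cs · surj k R + ∑[ C ← Cs ] 𝟙 (hits? M C)
  t≡ : t ≡ ∑[ C ← Cs ] (surj k R + 𝟙 (hits? M C))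
  t≡ = trans (cong (λ z → z + ∑[ C ← Cs ] 𝟙 (hits? M C)) (sym (∑-const Cs (surj k R)))) (sym (∑-+ Cs _ _))
  -- Conditioning is meaningful: with `p ≥ 1` there are at least two parts, so some assignment
  -- unties the whole matching.
  W>0 : 0 <ℕ ∑ V (weight M)
  W>0 = ℕ.*-cancelˡ-< (R ^ T) _ _ (subst₂ _<ℕ_ (sym (ℕ.*-zeroʳ (R ^ T))) (sym (∑-weight match))
    (ℕ.*-mono-≤ (ℕ.m^n>0 p {{ℕ.>-nonZero 1≤p}} T) (ℕ.m^n>0 R q)))

-- Each set is hit for at least one of the `q + q` candidate sums, so some sum hits at least the
-- average number of sets.
good-sum : ∀ {Cs : List (Subset q)} → All (λ C → 2 ≤ℕ ∣ C ∣) Cs → 1 ≤ℕ q →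
  ∃ λ s → length Cs ≤ℕ (q + q) · ∑[ C ← Cs ] 𝟙 (hits? (pairs q s) C)
good-sum {q} {Cs} sizes 1≤q = let s , le = ∑<∑⇒∃< (upTo Q) avg in s , ℕ.≤-pred le
  where
  open ℕ.≤-Reasoning
  Q = q + q
  hits : ℕ → ℕ
  hits s = ∑[ C ← Cs ] 𝟙 (hits? (pairs q s) C)
  ∑hits : length Cs ≤ℕ ∑ (upTo Q) hits
  ∑hits = begin
    length Cs               ≡⟨ ℕ.*-identityʳ (length Cs) ⟨
    length Cs · 1           ≡⟨ ∑-const Cs 1 ⟨
    ∑[ _ ← Cs ] 1           ≤⟨ ∑-monoᴬ (All.map (λ {C} → ∑-hits {C = C}) sizes) ⟩
    ∑[ C ← Cs ] ∑[ s ← upTo Q ] 𝟙 (hits? (pairs q s) C) ≡⟨ ∑-swap Cs (upTo Q) _ ⟩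
    ∑ (upTo Q) hits         ∎
  -- The `suc` makes the comparison strict, provided the range of sums is nonempty; this is where
  -- `1 ≤ q` enters.
  avg : ∑[ s ← upTo Q ] length Cs <ℕ ∑[ s ← upTo Q ] suc (Q · hits s)
  avg = begin-strict
    ∑[ s ← upTo Q ] length Cs              ≡⟨ ∑-const (upTo Q) (length Cs) ⟩
    length (upTo Q) · length Cs            ≡⟨ cong (_· length Cs) (length-upTo Q) ⟩
    Q · length Cs                          ≤⟨ ℕ.*-monoʳ-≤ Q ∑hits ⟩
    Q · ∑ (upTo Q) hits                    <⟨ ℕ.m<n+m _ (ℕ.≤-trans 1≤q (ℕ.m≤m+n q q)) ⟩
    Q + Q · ∑ (upTo Q) hits                ≡⟨ cong₂ _+_ Q≡ (sym (∑-*ˡ Q (upTo Q) hits)) ⟩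
    ∑[ s ← upTo Q ] 1 + ∑[ s ← upTo Q ] (Q · hits s) ≡⟨ ∑-+ (upTo Q) (λ _ → 1) (λ s → Q · hits s) ⟨
    ∑[ s ← upTo Q ] suc (Q · hits s)       ∎
    where
    Q≡ : Q ≡ ∑[ s ← upTo Q ] 1
    Q≡ = sym (trans (∑-const (upTo Q) 1) (trans (ℕ.*-identityʳ _) (length-upTo Q)))

good-assignment : ∀ {p} {Cs : List (Subset q)} → 1 ≤ℕ p → suc p ≤ℕ k → All (λ C → ∣ C ∣ ≡ k) Cs →
  ∃ λ (v : Vec (Fin (suc p)) q) →
    length Cs + (q + q) · (length Cs · surj k (suc p)) ≤ℕ (q + q) · (suc p ^ k · ∑[ C ← Cs ] onto C v)
-- Without edges `q` may be 0, leaving no sums to average over; any assignment will do.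
good-assignment {q} {Cs = []} 1≤p R≤k [] = replicate q zero , ℕ.≤-trans (ℕ.≤-reflexive (ℕ.*-zeroʳ (q + q))) z≤n
good-assignment {q} {k} {p} {Cs = Cs@(C ∷ _)} 1≤p R≤k sizes@(refl ∷ _) =
  let s , s-good = good-sum {Cs = Cs} (All.map (λ { eq → subst (2 ≤ℕ_) (sym eq) 2≤k }) sizes) 1≤q
      v , v-good = matching-assignment 1≤p R≤k (pairs-matching q s) sizes
      h = ∑[ C ← Cs ] 𝟙 (hits? (pairs q s) C)
  in v , (begin
    length Cs + Q · (length Cs · surj k R)  ≤⟨ ℕ.+-monoˡ-≤ _ s-good ⟩
    Q · h + Q · (length Cs · surj k R)      ≡⟨ lem Q h (length Cs · surj k R) ⟩
    Q · (length Cs · surj k R + h)          ≤⟨ ℕ.*-monoʳ-≤ Q v-good ⟩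
    Q · (R ^ k · ∑[ C ← Cs ] onto C v)      ∎)
  where
  open ℕ.≤-Reasoning
  R = suc p
  Q = q + q
  2≤k : 2 ≤ℕ k
  2≤k = ℕ.≤-trans (s≤s 1≤p) R≤k
  -- A set of at least two colours forces `q` to be positive.
  1≤q : 1 ≤ℕ q
  1≤q = ℕ.≤-trans (s≤s z≤n) (ℕ.≤-trans 2≤k (∣p∣≤n C))
  lem : ∀ a b c → a · b + a · c ≡ a · (c + b)
  lem = solve-∀

-- From colour sets back to the hypergraph.

-- Each part is taken by some colour of the edge, and that colour is carried by one of its vertices.
onto≤isCut : ∀ (f : Fin m → Fin q) (e : Subset m) (v : Vec (Fin r) q) →
  onto (im e f) v ≤ℕ 𝟙 (isCut? (lookup v ∘ f) e)
onto≤isCut f e v = 𝟙-mono covers (im (im e f) (lookup v) ≟ₛ ⊤) (isCut? (lookup v ∘ f) e)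
  where
  covers : im (im e f) (lookup v) ≡ ⊤ → ∀ j → ∃ λ u → u ∈ e × lookup v (f u) ≡ j
  covers eq j with i , i∈ , refl ← ∈-im⁻ (im e f) (lookup v) (subst (j ∈_) (sym eq) ∈⊤)
    with u , u∈ , refl ← ∈-im⁻ e f i∈ = u , u∈ , refl

-- The cut is the good assignment composed with the colouring. Colour sets are kept in a list, so
-- multiplicities of edges survive. The bound is multiplied by `2 χ r ^ k` to stay in the natural
-- numbers.
large-cut : ∀ {p χ} (H : Hypergraph k) → 1 ≤ℕ p → suc p ≤ℕ k → StrongColourable H χ →
  ∃ λ (cut : Cut H (suc p)) →
    numEdges H + (χ + χ) · (surj k (suc p) · numEdges H) ≤ℕ (χ + χ) · (suc p ^ k · cutSize H cut)
large-cut {k} {p} {χ} H 1≤p R≤k (f , strong) =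
  let v , v-good = good-assignment 1≤p R≤k sizes
      m = numEdges H
  in lookup v ∘ f , (begin
    m + Q · (surj k R · m)    ≡⟨ cong (λ z → m + Q · z) (ℕ.*-comm (surj k R) m) ⟩
    m + Q · (m · surj k R)    ≡⟨ cong (λ z → z + Q · (z · surj k R)) (length-map (λ e → im e f) (edges H)) ⟨
    length Cs + Q · (length Cs · surj k R)  ≤⟨ v-good ⟩
    Q · (R ^ k · ∑[ C ← Cs ] onto C v)
      ≡⟨ cong (λ z → Q · (R ^ k · sum z)) (map-∘ (edges H)) ⟨
    Q · (R ^ k · ∑[ e ← edges H ] onto (im e f) v)
      ≤⟨ ℕ.*-monoʳ-≤ Q (ℕ.*-monoʳ-≤ (R ^ k) (∑-mono (edges H) λ e → onto≤isCut f e v)) ⟩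
    Q · (R ^ k · ∑[ e ← edges H ] 𝟙 (isCut? (lookup v ∘ f) e))
      ≡⟨ cong (λ z → Q · (R ^ k · z)) (length-filter (isCut? (lookup v ∘ f)) (edges H)) ⟨
    Q · (R ^ k · cutSize H (lookup v ∘ f)) ∎)
  where
  open ℕ.≤-Reasoning
  R = suc p
  Q = χ + χ
  Cs = map (λ e → im e f) (edges H)
  -- A strong colouring is injective on every edge, so no colour set shrinks.
  sizes : All (λ C → ∣ C ∣ ≡ k) Cs
  sizes = All.map⁺ (All.zipWith (λ { {e} (size , inj) → trans (∣im∣ e f inj) size }) (uniform H , strong))

-- Passage to rational excess.

open import Data.Integer using (+_)

-- Divides the natural-number bound by `D + D`. Unnormalised rationals reduce the comparison to
-- integers, where the term in `t` can be moved across.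
excess-bound : ∀ m χ cut t D .{{_ : NonZero D}} .{{_ : NonZero (D + D)}} →
  m + (χ + χ) · t ≤ℕ (χ + χ) · (D · cut) →
  (+ 1 / (D + D)) * (+ m / 1) ≤ (+ χ / 1) * ((+ cut / 1) ℚ.- (+ t / D))
excess-bound m χ cut t D@(suc d) le = ℚ.toℚᵘ-cancel-≤ (begin
  toℚᵘ ((+ 1 / (D + D)) * (+ m / 1))
    ≃⟨ ℚᵘ.≃-trans (ℚ.toℚᵘ-homo-* (+ 1 / (D + D)) (+ m / 1))
         (ℚᵘ.*-cong (ℚ.toℚᵘ-fromℚᵘ (mkℚᵘ (+ 1) (d + D))) (ℚ.toℚᵘ-fromℚᵘ (mkℚᵘ (+ m) 0))) ⟩
  mkℚᵘ (+ 1) (d + D) ℚᵘ.* mkℚᵘ (+ m) 0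
    ≤⟨ *≤* ineq ⟩
  mkℚᵘ (+ χ) 0 ℚᵘ.* (mkℚᵘ (+ cut) 0 ℚᵘ.- mkℚᵘ (+ t) d)
    ≃⟨ ℚᵘ.*-cong (ℚ.toℚᵘ-fromℚᵘ (mkℚᵘ (+ χ) 0))
         (ℚᵘ.+-cong (ℚ.toℚᵘ-fromℚᵘ (mkℚᵘ (+ cut) 0)) (ℚᵘ.-‿cong (ℚ.toℚᵘ-fromℚᵘ (mkℚᵘ (+ t) d)))) ⟨
  toℚᵘ (+ χ / 1) ℚᵘ.* (toℚᵘ (+ cut / 1) ℚᵘ.- toℚᵘ (+ t / D))
    ≃⟨ ℚᵘ.*-congˡ {toℚᵘ (+ χ / 1)} (ℚᵘ.+-congʳ (toℚᵘ (+ cut / 1)) (ℚ.toℚᵘ-homo‿- (+ t / D))) ⟨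
  toℚᵘ (+ χ / 1) ℚᵘ.* (toℚᵘ (+ cut / 1) ℚᵘ.+ toℚᵘ (ℚ.- (+ t / D)))
    ≃⟨ ℚᵘ.*-congˡ {toℚᵘ (+ χ / 1)} (ℚ.toℚᵘ-homo-+ (+ cut / 1) (ℚ.- (+ t / D))) ⟨
  toℚᵘ (+ χ / 1) ℚᵘ.* toℚᵘ ((+ cut / 1) ℚ.- (+ t / D))
    ≃⟨ ℚ.toℚᵘ-homo-* (+ χ / 1) ((+ cut / 1) ℚ.- (+ t / D)) ⟨
  toℚᵘ ((+ χ / 1) * ((+ cut / 1) ℚ.- (+ t / D))) ∎)
  where
  open ℚᵘ.≤-Reasoning
  leℤ : + m ℤ.+ (+ χ ℤ.+ + χ) ℤ.* + t ℤ.≤ (+ χ ℤ.+ + χ) ℤ.* (+ D ℤ.* + cut)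
  leℤ = subst₂ ℤ._≤_
    (trans (ℤ.pos-+ m _) (cong (ℤ._+_ (+ m)) (ℤ.pos-* (χ + χ) t)))
    (trans (ℤ.pos-* (χ + χ) (D · cut)) (cong (ℤ._*_ (+ (χ + χ))) (ℤ.pos-* D cut)))
    (ℤ.+≤+ le)
  le′ : + m ℤ.≤ (+ χ ℤ.+ + χ) ℤ.* (+ D ℤ.* + cut) ℤ.- (+ χ ℤ.+ + χ) ℤ.* + t
  le′ = ℤ.≤-trans (ℤ.≤-reflexive (sym (cancel (+ m) ((+ χ ℤ.+ + χ) ℤ.* + t))))
                  (ℤ.+-monoˡ-≤ (ℤ.- ((+ χ ℤ.+ + χ) ℤ.* + t)) leℤ)
    where cancel : ∀ x y → x ℤ.+ y ℤ.- y ≡ x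
          cancel = ℤ-solve-∀
  -- The literal cross-multiplication of the fractions; up to trivial factors it is `le′` multiplied
  -- by `D`.
  ineq : (+ 1 ℤ.* + m) ℤ.* + (1 · (1 · D)) ℤ.≤
         (+ χ ℤ.* (+ cut ℤ.* + D ℤ.+ (ℤ.- + t) ℤ.* + 1)) ℤ.* + ((D + D) · 1)
  ineq = subst₂ ℤ._≤_
    (trans (lhs (+ m) (+ D)) (cong (λ z → (+ 1 ℤ.* + m) ℤ.* + z) (sym (trans (ℕ.*-identityˡ (1 · D)) (ℕ.*-identityˡ D)))))
    (trans (rhs (+ χ) (+ D) (+ cut) (+ t))
      (cong (λ z → (+ χ ℤ.* (+ cut ℤ.* + D ℤ.+ (ℤ.- + t) ℤ.* + 1)) ℤ.* + z) (sym (ℕ.*-identityʳ (D + D)))))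
    (ℤ.*-monoʳ-≤-nonNeg (+ D) le′)
    where
    lhs : ∀ m D → m ℤ.* D ≡ (+ 1 ℤ.* m) ℤ.* D
    lhs = ℤ-solve-∀
    rhs : ∀ χ D c t → ((χ ℤ.+ χ) ℤ.* (D ℤ.* c) ℤ.- (χ ℤ.+ χ) ℤ.* t) ℤ.* D
                    ≡ (χ ℤ.* (c ℤ.* D ℤ.+ (ℤ.- t) ℤ.* + 1)) ℤ.* (D ℤ.+ D)
    rhs = ℤ-solve-∀

theorem3p1 : (k r : ℕ) → 2 ≤ℕ r → r ≤ℕ k →
    Σ ℚ λ c → (0ℚ < c) ×
    ((H : Hypergraph k) (χ : ℕ) → IsStrongChromaticNumber H χ →
    ∃ λ (cut : Cut H r) →
    c * (+ numEdges H / 1) ≤ (+ χ / 1) * excess H cut)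
theorem3p1 k r@(suc p) (s≤s 1≤p) r≤k = c , c>0 , λ H χ (colourable , _) →
  let cut , bound = large-cut {χ = χ} H 1≤p r≤k colourable
  in cut , excess-bound (numEdges H) χ (cutSize H cut) (surj k r · numEdges H) D bound
  where
  D = r ^ k
  instance
    D≢0 : NonZero D
    D≢0 = ℕ.m^n≢0 r k
    D+D≢0 : NonZero (D + D)
    D+D≢0 = ℕ.>-nonZero (ℕ.≤-trans (ℕ.>-nonZero⁻¹ D) (ℕ.m≤m+n D D))
  -- One `D` is the denominator of the expected size, and a hit edge gains at least `1 / D`;
  -- doubling it accounts for the `χ + χ` candidate sums.
  c : ℚ
  c = + 1 / (D + D)
  c>0 : 0ℚ < c
  c>0 = ℚ.positive⁻¹ c {{ℚ.normalize-pos 1 (D + D)}}
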